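{- Let $\delta$ be an ordinal with $\mathrm{cf}(\omega^\delta)=\kappa\ge\omega$, and suppose $\omega^\delta=\sum_{\xi<\kappa}\omega^{\delta_\xi}$, where $\delta_\xi\le\delta_\zeta$ whenever $\xi<\zeta<\kappa$, and $\mathrm{cf}(\omega^{\delta_\xi})\ge\kappa$ for all $\xi<\kappa$. Then $\mathcal P_\kappa\hookrightarrow_c\mathrm{sq}\,\mathbb P(\omega^\delta)$.
   Context: $\mathbb P(\omega^\delta)$ is the poset of subsets of $\omega^\delta$ order-isomorphic to $\omega^\delta$, ordered by $\subset$; $\mathrm{sq}$ denotes separative quotient (antisymmetric quotient of the separative modification $p\le^*q\iff\forall r\le p\,\exists s\le r\, s\le q$). For a cardinal $\kappa$, $\mathcal P_\kappa=(P(\kappa)/[\kappa]^{<\kappa})^+$, the nonzero elements of the quotient of $P(\kappa)$ by the ideal of subsets of size $<\kappa$. A map $f:\mathbb P\to\mathbb Q$ between preorders is a complete embedding ($\hookrightarrow_c$) iff (1) $p_1\le p_2\Rightarrow f(p_1)\le f(p_2)$; (2) $p_1\perp p_2\iff f(p_1)\perp f(p_2)$; (3) for every $q\in\mathbb Q$ there is $p\in\mathbb P$ such that $f(p')$ is compatible with $q$ for all $p'\le p$. $\mathbb P\hookrightarrow_c\mathbb Q$ means such an $f$ exists. -}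

module Defs where

open import Level using (Level; Lift; lower) renaming (suc to lsuc; _⊔_ to _⊔ℓ_)
open import Data.Empty.Polymorphic using (⊥)
open import Data.Nat.Base using (ℕ; zero; suc)
open import Data.Product.Base using (Σ; Σ-syntax; ∃; _×_; _,_; proj₁)
open import Data.Sum.Base using (_⊎_; inj₁; inj₂; [_,_]′)
open import Data.Unit.Polymorphic.Base using (⊤)
open import Function.Base using (_on_)
open import Function.Bundles using (Bijection; _⇔_)
open import Relation.Binary.Bundles using (Setoid)
open import Relation.Binary.Bundles.Raw using (RawRelation)
open import Relation.Binary.Core using (Rel)
open import Relation.Binary.Definitions using (Reflexive; Transitive; _Respects_)
open import Relation.Binary.Structures using (IsEquivalence)
open import Relation.Binary.Construct.Interior.Symmetric as Interior using (SymInterior)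
open import Relation.Binary.Morphism.Structures using (IsOrderHomomorphism; IsOrderIsomorphism)
import Relation.Binary.Construct.On as On
open import Relation.Nullary.Negation.Core using (¬_)
open import Relation.Unary using (Pred; _⊆_; _∪_; _∖_)

private
  variable
    ℓ c c′ e e′ r r′ : Level

infix  4 _≤_ _<_ _≈_ _IsCofinalityOf_
infixl 6 _+_ _⊔_
infixl 7 _·_
infix  8 ω^_

------------------------------------------------------------------------
-- Ordinals

-- sup⁺ I f is the least ordinal strictly above every f i.  Distinct trees
-- may denote the same ordinal, so equality of ordinals is _≈_.  Given
-- excluded middle, _≤_ is a total order and _<_ is its strict part.
data Ord (ℓ : Level) : Set (lsuc ℓ) where
  sup⁺ : (I : Set ℓ) → (I → Ord ℓ) → Ord ℓ

_≤_ _<_ : Ord ℓ → Ord ℓ → Set ℓ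
sup⁺ I f ≤ β        = ∀ i → f i < β
α        < sup⁺ J g = ∃ λ j → α ≤ g j

_≈_ : Ord ℓ → Ord ℓ → Set ℓ
_≈_ = SymInterior _≤_

≤-refl : Reflexive (_≤_ {ℓ})
≤-refl {x = sup⁺ I f} i = i , ≤-refl

≤-trans   : Transitive (_≤_ {ℓ})
<-≤-trans : {α β γ : Ord ℓ} → α < β → β ≤ γ → α < γ
≤-trans {i = sup⁺ I f} p q i = <-≤-trans (p i) q
<-≤-trans {β = sup⁺ J g} {γ = sup⁺ K h} (j , p) q with q j
... | k , q′ = k , ≤-trans p q′

≤-<-trans : {α β γ : Ord ℓ} → α ≤ β → β < γ → α < γ
≤-<-trans {γ = sup⁺ K h} p (k , q) = k , ≤-trans p q

≈-isEquivalence : IsEquivalence (_≈_ {ℓ})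
≈-isEquivalence = Interior.isEquivalence ≤-refl ≤-trans

Ord-setoid : (ℓ : Level) → Setoid (lsuc ℓ) ℓ
Ord-setoid ℓ = record { Carrier = Ord ℓ ; isEquivalence = ≈-isEquivalence }

------------------------------------------------------------------------
-- Ordinal arithmetic
--
-- Zero, successor and limit cases are treated uniformly, since sup⁺ J g is
-- the supremum of the successors of the g j.

Branch : Ord ℓ → Set ℓ
Branch (sup⁺ I f) = I

branch : (α : Ord ℓ) → Branch α → Ord ℓ
branch (sup⁺ I f) = f

-- Non-strict suprema.
⨆ : (J : Set ℓ) → (J → Ord ℓ) → Ord ℓ
⨆ J h = sup⁺ (Σ J λ j → Branch (h j)) λ (j , i) → branch (h j) i

_⊔_ : Ord ℓ → Ord ℓ → Ord ℓ
α ⊔ β = sup⁺ (Branch α ⊎ Branch β) [ branch α , branch β ]′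

𝟎 𝟏 : Ord ℓ
𝟎 = sup⁺ ⊥ λ ()
𝟏 = sup⁺ ⊤ λ _ → 𝟎

fromℕ : ℕ → Ord ℓ
fromℕ zero    = 𝟎
fromℕ (suc n) = sup⁺ ⊤ λ _ → fromℕ n

ω : Ord ℓ
ω {ℓ} = sup⁺ (Lift ℓ ℕ) λ n → fromℕ (lower n)

-- α + β = sup (α, sup_{γ<β} ((α + γ) + 1))
_+_ : Ord ℓ → Ord ℓ → Ord ℓ
α + sup⁺ J g = sup⁺ (Branch α ⊎ J) [ branch α , (λ j → α + g j) ]′

-- α · β = sup_{γ<β} (α · γ + α)
_·_ : Ord ℓ → Ord ℓ → Ord ℓ
α · sup⁺ J g = ⨆ J λ j → α · g j + α

-- ω^β = sup (1, sup_{γ<β} (ω^γ · ω))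
ω^_ : Ord ℓ → Ord ℓ
ω^ sup⁺ J g = 𝟏 ⊔ ⨆ J λ j → ω^ (g j) · ω

-- ∑_{ξ<β} a ξ = sup_{γ<β} (∑_{ξ<γ} a ξ + a γ)
∑ : Ord ℓ → (Ord ℓ → Ord ℓ) → Ord ℓ
∑ (sup⁺ J g) a = ⨆ J λ j → ∑ (g j) a + a (g j)

------------------------------------------------------------------------
-- Cofinality

-- A β-sequence of ordinals; the values at arguments ≥ β are irrelevant.
record Sequence (β : Ord ℓ) : Set (lsuc ℓ) where
  field
    _[_] : Ord ℓ → Ord ℓ
    cong : ∀ {ξ ζ} → ξ < β → ξ ≈ ζ → _[_] ξ ≈ _[_] ζ

open Sequence public using (_[_])

CofinalMap : Ord ℓ → Ord ℓ → Set (lsuc ℓ)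
CofinalMap β α = Σ[ h ∈ Sequence β ]
    (∀ ξ → ξ < β → h [ ξ ] < α)
  × (∀ x → x < α → ∃ λ ξ → ξ < β × x ≤ h [ ξ ])

-- μ IsCofinalityOf α means cf(α) = μ: the least ordinal with a cofinal map
-- into α.
_IsCofinalityOf_ : Ord ℓ → Ord ℓ → Set (lsuc ℓ)
μ IsCofinalityOf α = CofinalMap μ α × (∀ β → CofinalMap β α → μ ≤ β)

------------------------------------------------------------------------
-- Subsets of an ordinal, seen as the set of smaller ordinals

record Subset (α : Ord ℓ) : Set (lsuc ℓ) where
  field
    pred    : Pred (Ord ℓ) ℓ
    resp    : pred Respects _≈_
    bounded : pred ⊆ (_< α)

open Subset public using (pred)

Element : {α : Ord ℓ} → Subset α → Set (lsuc ℓ)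
Element A = ∃ (pred A)

Element-setoid : {α : Ord ℓ} → Subset α → Setoid (lsuc ℓ) ℓ
Element-setoid {ℓ} A = On.setoid (Ord-setoid ℓ) (proj₁ {B = pred A})

full : (α : Ord ℓ) → Subset α
full α = record
  { pred    = _< α
  ; resp    = λ x≈y x<α → ≤-<-trans (SymInterior.rhs≤lhs x≈y) x<α
  ; bounded = λ x<α → x<α
  }

_∪ₛ_ _∖ₛ_ _△ₛ_ : {α : Ord ℓ} → Subset α → Subset α → Subset α
A ∪ₛ B = record
  { pred    = pred A ∪ pred B
  ; resp    = λ x≈y → λ where
      (inj₁ a) → inj₁ (Subset.resp A x≈y a)
      (inj₂ b) → inj₂ (Subset.resp B x≈y b)
  ; bounded = [ Subset.bounded A , Subset.bounded B ]′
  }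
A ∖ₛ B = record
  { pred    = pred A ∖ pred B
  ; resp    = λ x≈y (a , ¬b) →
      Subset.resp A x≈y a , λ b → ¬b (Subset.resp B (Interior.symmetric x≈y) b)
  ; bounded = λ (a , _) → Subset.bounded A a
  }
A △ₛ B = (A ∖ₛ B) ∪ₛ (B ∖ₛ A)

OrderIsomorphic : {α β : Ord ℓ} → Subset α → Subset β → Set (lsuc ℓ)
OrderIsomorphic A B = Σ[ f ∈ (Element A → Element B) ]
  IsOrderIsomorphism (_≈_ on proj₁) (_≈_ on proj₁) (_≤_ on proj₁) (_≤_ on proj₁) f

-- |A| < κ, for a cardinal (initial ordinal) κ.
Small : {κ : Ord ℓ} → Subset κ → Set (lsuc ℓ)
Small {κ = κ} A = ∃ λ β → β < κ × Bijection (Element-setoid A) (Element-setoid (full β))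

------------------------------------------------------------------------
-- Preorders and complete embeddings
--
-- A quotient is represented by its equality _≈_ on representatives.

module _ (P : RawRelation c e r) where
  open RawRelation P renaming (_∼_ to _⊑_)

  Compatible Incompatible : Rel Carrier (c ⊔ℓ r)
  Compatible   p q = ∃ λ s → s ⊑ p × s ⊑ q
  Incompatible p q = ¬ Compatible p q

  _≤*_ : Rel Carrier (c ⊔ℓ r)
  p ≤* q = ∀ s → s ⊑ p → ∃ λ t → t ⊑ s × t ⊑ q

  sq : RawRelation c (c ⊔ℓ r) (c ⊔ℓ r)
  sq = record { Carrier = Carrier ; _≈_ = SymInterior _≤*_ ; _∼_ = _≤*_ }

module _ (P : RawRelation c e r) (Q : RawRelation c′ e′ r′) where
  private
    module P = RawRelation P
    module Q = RawRelation Q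

  record IsCompleteEmbedding (f : P.Carrier → Q.Carrier)
         : Set (c ⊔ℓ e ⊔ℓ r ⊔ℓ c′ ⊔ℓ e′ ⊔ℓ r′) where
    field
      isOrderHomomorphism : IsOrderHomomorphism P._≈_ Q._≈_ P._∼_ Q._∼_ f
      incompatible        : ∀ p₁ p₂ → Incompatible P p₁ p₂ ⇔ Incompatible Q (f p₁) (f p₂)
      reduction           : ∀ q → ∃ λ p → ∀ p′ → p′ P.∼ p → Compatible Q (f p′) q

  _↪c_ : Set (c ⊔ℓ e ⊔ℓ r ⊔ℓ c′ ⊔ℓ e′ ⊔ℓ r′)
  _↪c_ = ∃ IsCompleteEmbedding

------------------------------------------------------------------------
-- The two posets

-- The copies of α inside α, ordered by inclusion.
ℙ : Ord ℓ → RawRelation (lsuc ℓ) (lsuc ℓ) (lsuc ℓ)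
ℙ α = record
  { Carrier = Σ[ A ∈ Subset α ] OrderIsomorphic A (full α)
  ; _≈_     = SymInterior _≲_
  ; _∼_     = _≲_
  }
  where
  _≲_ = (λ A B → pred A ⊆ pred B) on proj₁

-- (P(κ) / [κ]^{<κ})⁺, for a cardinal κ.
𝒫 : Ord ℓ → RawRelation (lsuc ℓ) (lsuc ℓ) (lsuc ℓ)
𝒫 κ = record
  { Carrier = Σ[ A ∈ Subset κ ] ¬ Small A
  ; _≈_     = (λ A B → Small (A △ₛ B)) on proj₁
  ; _∼_     = (λ A B → Small (A ∖ₛ B)) on proj₁
  }

{-# OPTIONS --safe #-}
module Submission where

-- Cut Ω = ω^δ into consecutive blocks, block ξ < κ having type ω^(δ_ξ), and
-- send A ⊆ κ to the union of the blocks with index in A.  Since Ω is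
-- indecomposable and κ is its cofinality, sets of size < κ are the bounded
-- ones, and a subset of Ω contains a copy of Ω as soon as, for all ξ < κ,
-- arbitrarily late blocks meet it in type ≥ ω^(δ_ξ).  Conversely, every copy
-- C of Ω has this property: otherwise, as ω^(δ_ξ) is indecomposable of
-- cofinality ≥ κ, the type of C would be at most ω^(δ_ξ) < Ω.  Choosing for
-- each ξ the least block index ≥ ξ at which C is that large gives A such that
-- the blocks of every large subset of A meet C in a copy of Ω.

open import Defs
open import Level using (Level; suc; Lift; lift; lower)
open import Axiom.ExcludedMiddle using (ExcludedMiddle)
open import Data.Empty using (⊥-elim)
open import Data.Nat.Base using (ℕ) renaming (zero to zeroℕ; suc to sucℕ)
open import Data.Product.Base using (∃; _×_; _,_; proj₁; proj₂)
open import Data.Sum.Base using (_⊎_; inj₁; inj₂; [_,_]′)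
open import Data.Unit.Polymorphic.Base using (⊤)
open import Function.Bundles using (mk⇔; Bijection)
open import Induction.WellFounded using (Acc; acc; WellFounded)
open import Relation.Binary.Bundles.Raw using (RawRelation)
open import Relation.Binary.Construct.Interior.Symmetric using (_,_; lhs≤rhs; rhs≤lhs)
open import Relation.Binary.Morphism.Structures using (IsOrderIsomorphism)
open import Relation.Nullary using (¬_; Dec; yes; no)
open import Relation.Unary using (Pred; _⊆_; _∩_)

private
  variable
    ℓ : Level
    α β γ α′ β′ : Ord ℓ

-- Order and arithmetic of ordinals

<⇒≤ : α < β → α ≤ β
<⇒≤ {α = sup⁺ I f} {β = sup⁺ J g} (j , p) i = j , <⇒≤ (p i)

<-irrefl : ¬ α < α
<-irrefl {α = sup⁺ I f} (i , p) = <-irrefl (p i)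

<⇒≱ : α < β → ¬ β ≤ α
<⇒≱ p q = <-irrefl (<-≤-trans p q)

<-trans : α < β → β < γ → α < γ
<-trans p q = <-≤-trans p (<⇒≤ q)

<-wellFounded : WellFounded (_<_ {ℓ})
<-wellFounded α = below α ≤-refl
  where
  below : (α : Ord ℓ) → β ≤ α → Acc _<_ β
  below (sup⁺ I f) p = acc λ q → let (i , r) = <-≤-trans q p in below (f i) r

branch< : (α : Ord ℓ) (i : Branch α) → branch α i < α
branch< (sup⁺ I f) i = i , ≤-refl

≤-fromBranch : (∀ i → branch α i < β) → α ≤ β
≤-fromBranch {α = sup⁺ I f} p = p

sucₒ : Ord ℓ → Ord ℓ
sucₒ α = sup⁺ ⊤ λ _ → α

<sucₒ : α < sucₒ α
<sucₒ = _ , ≤-refl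

<sucₒ⇒≤ : α < sucₒ β → α ≤ β
<sucₒ⇒≤ (_ , p) = p

≤⨆ : {J : Set ℓ} (h : J → Ord ℓ) (j : J) → h j ≤ ⨆ J h
≤⨆ h j = ≤-fromBranch λ i → (j , i) , ≤-refl

⨆≤ : {J : Set ℓ} {h : J → Ord ℓ} → (∀ j → h j ≤ β) → ⨆ J h ≤ β
⨆≤ {h = h} p (j , i) = <-≤-trans (branch< (h j) i) (p j)

<⨆ : {J : Set ℓ} (h : J → Ord ℓ) → α < ⨆ J h → ∃ λ j → α < h j
<⨆ h ((j , i) , p) = j , ≤-<-trans p (branch< (h j) i)

α≤α+β : α ≤ α + β
α≤α+β {β = sup⁺ J g} = ≤-fromBranch λ i → inj₁ i , ≤-refl

+-monoʳ-≤ : β ≤ β′ → α + β ≤ α + β′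
+-monoʳ-< : β < β′ → α + β < α + β′
+-monoʳ-≤ {β = sup⁺ J g} {α = α} p (inj₁ i) = <-≤-trans (branch< α i) α≤α+β
+-monoʳ-≤ {β = sup⁺ J g} p (inj₂ j) = +-monoʳ-< (p j)
+-monoʳ-< {β′ = sup⁺ K h} (k , p) = inj₂ k , +-monoʳ-≤ p

+-monoˡ-≤ : α ≤ α′ → α + β ≤ α′ + β
+-monoˡ-≤ {α = α} {β = β@(sup⁺ J g)} p (inj₁ i) =
  <-≤-trans (branch< α i) (≤-trans p (α≤α+β {β = β}))
+-monoˡ-≤ {β = sup⁺ J g} p (inj₂ j) = inj₂ j , +-monoˡ-≤ p

+-mono-≤ : α ≤ α′ → β ≤ β′ → α + β ≤ α′ + β′
+-mono-≤ p q = ≤-trans (+-monoˡ-≤ p) (+-monoʳ-≤ q)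

𝟎+β≤β : 𝟎 + β ≤ β
𝟎+β≤β {β = sup⁺ J g} (inj₂ j) = j , 𝟎+β≤β

β≤α+β : β ≤ α + β
β≤α+β {β = sup⁺ J g} j = inj₂ j , β≤α+β

α<α+β : 𝟎 < β → α < α + β
α<α+β {β = sup⁺ J g} (j , _) = inj₂ j , α≤α+β

+-assoc-≤ : (α β γ : Ord ℓ) → α + (β + γ) ≤ (α + β) + γ
+-assoc-≤ α β γ@(sup⁺ K h) (inj₁ i) = <-≤-trans (branch< α i) (≤-trans (α≤α+β {β = β}) (α≤α+β {β = γ}))
+-assoc-≤ α β (sup⁺ K h) (inj₂ (inj₁ j)) = <-≤-trans (+-monoʳ-< (branch< β j)) α≤α+β
+-assoc-≤ α β (sup⁺ K h) (inj₂ (inj₂ k)) = inj₂ k , +-assoc-≤ α β (h k)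

·-monoˡ-≤ : α ≤ α′ → α · β ≤ α′ · β
·-monoˡ-≤ {α′ = α′} {β = sup⁺ J g} p =
  ⨆≤ λ j → ≤-trans (+-mono-≤ (·-monoˡ-≤ p) p) (≤⨆ (λ j → α′ · g j + α′) j)

ω^·ω≤ω^ : {J : Set ℓ} (g : J → Ord ℓ) (j : J) → ω^ (g j) · ω ≤ ω^ sup⁺ J g
ω^·ω≤ω^ g j = ≤-fromBranch λ i → inj₂ (j , i) , ≤-refl

ω^-mono-≤ : α ≤ β → ω^ α ≤ ω^ β
ω^-mono-≤ {α = sup⁺ J g} {β = sup⁺ K h} p (inj₁ i) = inj₁ i , ≤-refl
ω^-mono-≤ {α = sup⁺ J g} {β = sup⁺ K h} p (inj₂ (j , i)) =
  let (k , q) = p j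
  in <-≤-trans (<-≤-trans (branch< (ω^ (g j) · ω) i) (·-monoˡ-≤ (ω^-mono-≤ q))) (ω^·ω≤ω^ h k)

𝟎<ω^ : (α : Ord ℓ) → 𝟎 < ω^ α
𝟎<ω^ (sup⁺ J g) = inj₁ _ , λ ()

-- Additively indecomposable ordinals.

_IsIndecomposable : Ord ℓ → Set _
γ IsIndecomposable = ∀ {α β} → α < γ → β < γ → α + β < γ

module _ (π : Ord ℓ) (𝟎<π : 𝟎 < π) where

  private
    π·[1+n]≤ : ∀ n → π · fromℕ (sucℕ n) ≤ π · fromℕ n + π
    π·[1+n]≤ n = ⨆≤ λ _ → ≤-refl {x = π · fromℕ n + π}

    ≤π·[1+n] : ∀ n → π · fromℕ n + π ≤ π · fromℕ (sucℕ n)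
    ≤π·[1+n] n = ≤⨆ (λ _ → π · fromℕ n + π) _

    π·n+π≤π·ω : ∀ n → π · fromℕ n + π ≤ π · ω
    π·n+π≤π·ω n = ≤⨆ (λ n → π · fromℕ (lower n) + π) (lift n)

    <π·ω⇒ : α < π · ω → ∃ λ n → α ≤ π · fromℕ n
    <π·ω⇒ p with <⨆ (λ n → π · fromℕ (lower n) + π) p
    ... | lift n , q = sucℕ n , ≤-trans (<⇒≤ q) (≤π·[1+n] n)

    ≤π·n⇒ : ∀ n → α ≤ π · fromℕ n → α < π · ω
    ≤π·n⇒ n p = ≤-<-trans p (<-≤-trans (α<α+β 𝟎<π) (π·n+π≤π·ω n))

    +π·n : ∀ m → α < π · ω → α + π · fromℕ m < π · ω
    +π·n {α = α} zeroℕ p = ≤-<-trans (λ { (inj₁ i) → branch< α i }) p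
    +π·n {α = α} (sucℕ m) p =
      let (n , q) = <π·ω⇒ (+π·n m p)
      in ≤π·n⇒ (sucℕ n)
        (≤-trans (+-monoʳ-≤ (π·[1+n]≤ m))
          (≤-trans (+-assoc-≤ α (π · fromℕ m) π)
            (≤-trans (+-monoˡ-≤ q) (≤π·[1+n] n))))

  -- Every ordinal below `π · ω` is bounded by a finite multiple of `π`, and adding finitely many
  -- further copies of `π` again gives such a bound.
  ·ω-isIndecomposable : (π · ω) IsIndecomposable
  ·ω-isIndecomposable p q = let (m , r) = <π·ω⇒ q in ≤-<-trans (+-monoʳ-≤ r) (+π·n m p)

-- Relative order types

infix 4 _≤⟨_⟩_

-- α ≤⟨ X ⟩ x says that the elements of X below x have order type at least α.
_≤⟨_⟩_ : Ord ℓ → Pred (Ord ℓ) ℓ → Ord ℓ → Set (suc ℓ)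
sup⁺ I f ≤⟨ X ⟩ x = ∀ i → ∃ λ y → X y × y < x × f i ≤⟨ X ⟩ y

private
  variable
    X Y : Pred (Ord ℓ) ℓ
    x x′ y : Ord ℓ

≤⟨⟩-below : α ≤⟨ X ⟩ x → β < α → ∃ λ y → X y × y < x × β ≤⟨ X ⟩ y
≤⟨⟩-mono : β ≤ α → α ≤⟨ X ⟩ x → β ≤⟨ X ⟩ x
≤⟨⟩-below {α = sup⁺ I f} p (i , q) with p i
... | y , y∈X , y<x , r = y , y∈X , y<x , ≤⟨⟩-mono q r
≤⟨⟩-mono {β = sup⁺ J g} q p j = ≤⟨⟩-below p (q j)

≤⟨⟩-fromBelow : (∀ {β} → β < α → ∃ λ y → X y × y < x × β ≤⟨ X ⟩ y) → α ≤⟨ X ⟩ x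
≤⟨⟩-fromBelow {α = sup⁺ I f} p i = p (i , ≤-refl)

≤⟨⟩⇒≤ : α ≤⟨ X ⟩ x → α ≤ x
≤⟨⟩⇒≤ {α = sup⁺ I f} p i =
  let (y , _ , y<x , q) = p i in ≤-<-trans (≤⟨⟩⇒≤ q) y<x

≤⟨⟩-resp-⊆ : (∀ {y} → y < x → X y → Y y) → α ≤⟨ X ⟩ x → α ≤⟨ Y ⟩ x
≤⟨⟩-resp-⊆ {α = sup⁺ I f} s p i with p i
... | y , y∈X , y<x , q =
  y , s y<x y∈X , y<x , ≤⟨⟩-resp-⊆ (λ z<y → s (<-trans z<y y<x)) q

≤⟨⟩-shrink : (∀ {y} → X y → y < x → y < x′) → α ≤⟨ X ⟩ x → α ≤⟨ X ⟩ x′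
≤⟨⟩-shrink {α = sup⁺ I f} s p i with p i
... | y , y∈X , y<x , q = y , y∈X , s y∈X y<x , q

≤⟨⟩-extend : x ≤ x′ → α ≤⟨ X ⟩ x → α ≤⟨ X ⟩ x′
≤⟨⟩-extend x≤x′ = ≤⟨⟩-shrink λ _ y<x → <-≤-trans y<x x≤x′

≤⟨⟩-⨆ : {J : Set ℓ} {h : J → Ord ℓ} → (∀ j → h j ≤⟨ X ⟩ x) → ⨆ J h ≤⟨ X ⟩ x
≤⟨⟩-⨆ {h = h} p (j , i) = ≤⟨⟩-below (p j) (branch< (h j) i)

-- Points of `X` in positions from `α` on have type `α` of `X` below them, so they all belong to
-- `Y`, and they still realise `β`.
≤⟨⟩-drop : (∀ {y} → X y → α ≤⟨ X ⟩ y → Y y) → α + β ≤⟨ X ⟩ x → β ≤⟨ Y ⟩ x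
≤⟨⟩-drop {β = sup⁺ J g} s p j with p (inj₂ j)
... | y , y∈X , y<x , q = y , s y∈X (≤⟨⟩-mono α≤α+β q) , y<x , ≤⟨⟩-drop s q

≤⟨⟩-append : α ≤⟨ X ⟩ y → (∀ {z} → Y z → X z × y ≤ z) → y ≤ x →
             β ≤⟨ Y ⟩ x → α + β ≤⟨ X ⟩ x
≤⟨⟩-append {β = sup⁺ J g} p s y≤x q (inj₁ i) =
  let (z , z∈X , z<y , r) = ≤⟨⟩-below p (branch< _ i)
  in z , z∈X , <-≤-trans z<y y≤x , r
≤⟨⟩-append {β = sup⁺ J g} p s y≤x q (inj₂ j) with q j
... | z , z∈Y , z<x , r =
  let (z∈X , y≤z) = s z∈Y in z , z∈X , z<x , ≤⟨⟩-append p s y≤z r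

-- Each position below `β` is realised by `α` plus that position. The bound `γ` stays fixed while
-- `β` descends in the recursion.
≤⟨⟩-interval : β ≤ γ → (∀ {y} → α ≤ y → y < α + γ → X y) → β ≤⟨ X ⟩ (α + β)
≤⟨⟩-interval {β = sup⁺ J g} p s j =
  _ , s α≤α+β (+-monoʳ-< (p j)) , (inj₂ j , ≤-refl) , ≤⟨⟩-interval (<⇒≤ (p j)) s

-- Transfinite sums.

<∑ : {a : Ord ℓ → Ord ℓ} → α < ∑ β a → ∃ λ ξ → ξ < β × α < ∑ ξ a + a ξ
<∑ {β = sup⁺ J g} {a = a} p with <⨆ (λ j → ∑ (g j) a + a (g j)) p
... | j , q = g j , (j , ≤-refl) , q

∑-≤⟨⟩ : {a : Ord ℓ → Ord ℓ} → (∀ {ξ} → ξ < β → ∑ ξ a + a ξ ≤⟨ X ⟩ x) → ∑ β a ≤⟨ X ⟩ x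
∑-≤⟨⟩ {β = sup⁺ J g} p = ≤⟨⟩-⨆ λ j → p (j , ≤-refl)

module _ {κ : Ord ℓ} {a : Ord ℓ → Ord ℓ}
         (a-mono : ∀ {ξ ζ} → ξ ≤ ζ → ζ < κ → a ξ ≤ a ζ) where

  -- Some `ξ < ζ` is only known to lie below a branch of `ζ`; monotonicity of `a` carries the
  -- summand at `ξ` to the one at that branch.
  ∑-mono-≤ : ∀ {ξ ζ} → ξ ≤ ζ → ζ ≤ κ → ∑ ξ a ≤ ∑ ζ a
  ∑-+≤∑ : ∀ {ξ ζ} → ξ < ζ → ζ ≤ κ → ∑ ξ a + a ξ ≤ ∑ ζ a
  ∑-mono-≤ {sup⁺ I f} p q = ⨆≤ λ i → ∑-+≤∑ (p i) q
  ∑-+≤∑ {ζ = sup⁺ J g} (j , p) q =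
    ≤-trans (+-mono-≤ (∑-mono-≤ p (<⇒≤ (q j))) (a-mono p (q j))) (≤⨆ (λ j → ∑ (g j) a + a (g j)) j)

_∩ₛ_ : {α : Ord ℓ} → Subset α → Subset α → Subset α
A ∩ₛ B = record
  { pred    = pred A ∩ pred B
  ; resp    = λ x≈y (a , b) → Subset.resp A x≈y a , Subset.resp B x≈y b
  ; bounded = λ (a , _) → Subset.bounded A a
  }

-- Linearity, least elements and indecomposability from excluded middle.

module Classical {ℓ : Level} (em : ExcludedMiddle (suc ℓ)) where

  emₗ : {P : Set ℓ} → Dec P
  emₗ {P} with em {Lift _ P}
  ... | yes (lift p) = yes p
  ... | no ¬p = no λ p → ¬p (lift p)

  byContradiction : {P : Set (suc ℓ)} → ¬ ¬ P → P
  byContradiction {P} ¬¬p with em {P}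
  ... | yes p = p
  ... | no ¬p = ⊥-elim (¬¬p ¬p)

  byContradictionₗ : {P : Set ℓ} → ¬ ¬ P → P
  byContradictionₗ ¬¬p = lower (byContradiction λ ¬p → ¬¬p λ p → ¬p (lift p))

  ≤⊎> : (α β : Ord ℓ) → α ≤ β ⊎ β < α
  ≤⊎> (sup⁺ I f) β with emₗ {∃ λ i → β ≤ f i}
  ... | yes p = inj₂ p
  -- The recursion swaps the arguments: as no `f i` is at least `β`, comparing `β` with `f i` leaves
  -- `f i < β`.
  ... | no ¬p = inj₁ λ i → [ (λ q → ⊥-elim (¬p (i , q))) , (λ q → q) ]′ (≤⊎> β (f i))

  ≮⇒≥ : {α β : Ord ℓ} → ¬ α < β → β ≤ α
  ≮⇒≥ {α} {β} p = [ (λ q → q) , (λ q → ⊥-elim (p q)) ]′ (≤⊎> β α)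

  ≰⇒> : {α β : Ord ℓ} → ¬ α ≤ β → β < α
  ≰⇒> {α} {β} p = [ (λ q → ⊥-elim (p q)) , (λ q → q) ]′ (≤⊎> α β)

  ≤⇒<⊎≈ : {α β : Ord ℓ} → α ≤ β → α < β ⊎ α ≈ β
  ≤⇒<⊎≈ {α} {β} p = [ (λ q → inj₂ (p , q)) , inj₁ ]′ (≤⊎> β α)

  upperBound : {α β γ : Ord ℓ} → α < γ → β < γ → ∃ λ ζ → ζ < γ × α ≤ ζ × β ≤ ζ
  upperBound {α} {β} p q =
    [ (λ r → β , q , r , ≤-refl) , (λ r → α , p , ≤-refl , <⇒≤ r) ]′ (≤⊎> α β)

  _IsLeast_ : Ord ℓ → (Ord ℓ → Set (suc ℓ)) → Set (suc ℓ)
  α IsLeast P = P α × (∀ {β} → P β → α ≤ β)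

  least : {P : Ord ℓ → Set (suc ℓ)} → ∃ P → ∃ (_IsLeast P)
  least {P} (α , p) = search (<-wellFounded α) p
    where
    search : ∀ {α} → Acc _<_ α → P α → ∃ (_IsLeast P)
    search {α} (acc rs) p with em {∃ λ β → β < α × P β}
    ... | yes (β , β<α , q) = search (rs β<α) q
    ... | no ¬q = α , p , λ q → ≮⇒≥ λ β<α → ¬q (_ , β<α , q)

  -- Made total so that it can serve as the value of a `Sequence`; `𝟎` is a junk value for empty
  -- `P`.
  leastOr𝟎 : (Ord ℓ → Set (suc ℓ)) → Ord ℓ
  leastOr𝟎 P with em {∃ P}
  ... | yes p = proj₁ (least p)
  ... | no _ = 𝟎

  leastOr𝟎-isLeast : (P : Ord ℓ → Set (suc ℓ)) → ∃ P → leastOr𝟎 P IsLeast P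
  leastOr𝟎-isLeast P p with em {∃ P}
  ... | yes q = proj₂ (least q)
  ... | no ¬q = ⊥-elim (¬q p)

  -- An ordinal below the power is `𝟎` or lies below some `ω^ (g j) · ω`. For two of the latter
  -- kind, the larger exponent serves both, and `ω^ (g j) · ω` is indecomposable.
  ω^-isIndecomposable : (γ : Ord ℓ) → (ω^ γ) IsIndecomposable
  ω^-isIndecomposable (sup⁺ J g) {α} {β} p q with p | q
  ... | inj₁ _ , α≤𝟎 | _ = ≤-<-trans (≤-trans (+-monoˡ-≤ α≤𝟎) 𝟎+β≤β) q
  ... | inj₂ _ , _ | inj₁ _ , β≤𝟎 =
    ≤-<-trans (+-monoʳ-≤ β≤𝟎) (≤-<-trans (λ { (inj₁ i) → branch< α i }) p)
  ... | inj₂ (j , i) , α≤ | inj₂ (k , l) , β≤ =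
    [ (λ r → add k (<-≤-trans α< (·-monoˡ-≤ (ω^-mono-≤ r))) β<)
    , (λ r → add j α< (<-≤-trans β< (·-monoˡ-≤ (ω^-mono-≤ (<⇒≤ r)))))
    ]′ (≤⊎> (g j) (g k))
    where
    α< = ≤-<-trans α≤ (branch< _ i)
    β< = ≤-<-trans β≤ (branch< _ l)
    add : ∀ j → α < ω^ (g j) · ω → β < ω^ (g j) · ω → α + β < ω^ sup⁺ J g
    add j p q = <-≤-trans (·ω-isIndecomposable _ (𝟎<ω^ (g j)) p q) (ω^·ω≤ω^ g j)

  -- Subsets and their order types

  module _ {α : Ord ℓ} (X : Subset α) where

    private
      RankBound : Ord ℓ → Ord ℓ → Set (suc ℓ)
      RankBound x β = ∀ {y} → pred X y → y < x → ¬ β ≤⟨ pred X ⟩ y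

      -- The order type of the part of `X` below `x`.
      rank : Ord ℓ → Ord ℓ
      rank x = leastOr𝟎 (RankBound x)

      rank-isLeast : ∀ x → rank x IsLeast RankBound x
      rank-isLeast x = leastOr𝟎-isLeast (RankBound x) (x , λ _ y<x p → <⇒≱ y<x (≤⟨⟩⇒≤ p))

      rank≤⟨⟩ : ∀ x → rank x ≤⟨ pred X ⟩ x
      rank≤⟨⟩ x = ≤⟨⟩-fromBelow λ β<r → byContradiction λ ¬p →
        <⇒≱ β<r (proj₂ (rank-isLeast x) λ y∈X y<x q → ¬p (_ , y∈X , y<x , q))

      rank-mono : ∀ {x y} → x ≤ y → rank x ≤ rank y
      rank-mono {x} {y} x≤y = proj₂ (rank-isLeast x) λ z∈X z<x →
        proj₁ (rank-isLeast y) z∈X (<-≤-trans z<x x≤y)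

      rank-cancel : ∀ {x y} → pred X y → rank x ≤ rank y → x ≤ y
      rank-cancel {x} {y} y∈X p = ≮⇒≥ λ y<x →
        proj₁ (rank-isLeast x) y∈X y<x (≤⟨⟩-mono p (rank≤⟨⟩ y))

    -- The isomorphism is `rank`; the hypotheses say that its values on `X` are cofinal in `β` and
    -- stay below `β`.
    ≅full : ∀ {β} → (∀ {γ} → γ < β → ∃ λ y → pred X y × γ ≤⟨ pred X ⟩ y) →
            (∀ {y} → pred X y → ¬ β ≤⟨ pred X ⟩ y) → OrderIsomorphic X (full β)
    ≅full {β} lower upper = to , record
      { isOrderMonomorphism = record
        { isOrderHomomorphism = record
          { cong = λ (p , q) → rank-mono p , rank-mono q
          ; mono = rank-mono
          }
        ; injective = λ { {_ , x∈X} {_ , y∈X} (p , q) → rank-cancel y∈X p , rank-cancel x∈X q }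
        ; cancel = λ { {_} {_ , y∈X} p → rank-cancel y∈X p }
        }
      ; surjective = λ (γ , γ<β) →
          -- By minimality, the least `y` in `X` with type at least `γ` below it has rank exactly
          -- `γ`.
          let (y , (y∈X , γ≤y) , y-min) = least (lower γ<β)
              r≤γ = proj₂ (rank-isLeast y) λ z∈X z<y p → <⇒≱ z<y (y-min (z∈X , p))
              γ≤r = ≮⇒≥ λ r<γ → let (z , z∈X , z<y , p) = ≤⟨⟩-below γ≤y r<γ
                                in proj₁ (rank-isLeast y) z∈X z<y p
          in (y , y∈X) , λ (p , q) → ≤-trans (rank-mono p) r≤γ , ≤-trans γ≤r (rank-mono q)
      }
      where
      to : Element X → Element (full β)
      to (x , x∈X) = rank x , ≰⇒> λ β≤r → upper x∈X (≤⟨⟩-mono β≤r (rank≤⟨⟩ x))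

    -- The working form of being a copy of `α`: a subset of `α` never has larger type, so only lower
    -- bounds on the type are demanded.
    Large : Set (suc ℓ)
    Large = ∀ {β} → β < α → ∃ λ y → pred X y × β ≤⟨ pred X ⟩ y

    large⇒copy : Large → OrderIsomorphic X (full α)
    large⇒copy p = ≅full p λ y∈X q → <⇒≱ (Subset.bounded X y∈X) (≤⟨⟩⇒≤ q)

    -- The preimage of `β` has type at least `β` of `X` below it, by recursion through the preimages
    -- of smaller ordinals.
    copy⇒large : OrderIsomorphic X (full α) → Large
    copy⇒large (f , iso) {β} β<α = proj₁ (g β<α) , proj₂ (g β<α) , ≤⟨⟩g β<α
      where
      open IsOrderIsomorphism iso
      g : ∀ {β} → β < α → Element X
      g β<α = proj₁ (surjective (_ , β<α))
      fg : ∀ {β} (β<α : β < α) → proj₁ (f (g β<α)) ≈ β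
      fg β<α = proj₂ (surjective (_ , β<α)) (≤-refl , ≤-refl)
      ≤⟨⟩g : ∀ {β} (β<α : β < α) → β ≤⟨ pred X ⟩ proj₁ (g β<α)
      ≤⟨⟩g {sup⁺ I h} β<α i = _ , proj₂ (g hi<α) , ≰⇒> gβ≰ghi , ≤⟨⟩g hi<α
        where
        hi<α : h i < α
        hi<α = <-trans (i , ≤-refl) β<α
        gβ≰ghi : ¬ proj₁ (g β<α) ≤ proj₁ (g hi<α)
        gβ≰ghi p = <-irrefl (<-≤-trans (i , ≤-refl)
          (≤-trans (rhs≤lhs (fg β<α)) (≤-trans (mono p) (lhs≤rhs (fg hi<α)))))

    Bounded : Set (suc ℓ)
    Bounded = ∃ λ η → η < α × (∀ {x} → pred X x → x < η)

    -- The least `β` not attained in `X` is the order type of `X`, and it is at most `η`.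
    bounded⇒small : Bounded → Small X
    bounded⇒small (η , η<α , X<η) with least {λ β → ∀ {y} → pred X y → ¬ β ≤⟨ pred X ⟩ y}
                                         (η , λ y∈X p → <⇒≱ (X<η y∈X) (≤⟨⟩⇒≤ p))
    ... | β , upper , β-min = β , ≤-<-trans β≤η η<α , record
      { to = proj₁ iso
      ; cong = λ {x} {y} → cong {x} {y}
      ; bijective = (λ {x} {y} → injective {x} {y}) , surjective
      }
      where
      β≤η = β-min λ y∈X p → <⇒≱ (X<η y∈X) (≤⟨⟩⇒≤ p)
      iso = ≅full (λ γ<β → byContradiction λ ¬p →
        <⇒≱ γ<β (β-min λ y∈X q → ¬p (_ , y∈X , q))) upper
      open IsOrderIsomorphism (proj₂ iso)

  bounded-resp-⊇ : {α : Ord ℓ} (X Y : Subset α) → pred X ⊆ pred Y → Bounded Y → Bounded X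
  bounded-resp-⊇ _ _ X⊆Y (η , η<α , Y<η) = η , η<α , λ x∈X → Y<η (X⊆Y x∈X)

  -- Without a common bound, sending `ζ` to the least `b` with `P ζ b` would be a cofinal map from
  -- `η < μ` into `γ`.
  collection : {μ γ η : Ord ℓ} → μ IsCofinalityOf γ → η < μ →
    (P : Ord ℓ → Ord ℓ → Set (suc ℓ)) →
    (∀ {ζ ζ′ b} → ζ < η → ζ ≈ ζ′ → P ζ b → P ζ′ b) →
    (∀ {ζ b b′} → b ≤ b′ → P ζ b → P ζ b′) →
    (∀ {ζ} → ζ < η → ∃ λ b → b < γ × P ζ b) →
    ∃ λ b → b < γ × (∀ {ζ} → ζ < η → P ζ b)
  collection {μ} {γ} {η} (_ , μ-min) η<μ P P-resp P-up bound = byContradiction λ ¬b →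
      <⇒≱ η<μ (μ-min η (record { _[_] = v ; cong = v-cong } , v<γ , λ x x<γ →
        byContradiction λ ¬q → ¬b (x , x<γ , λ {ζ} ζ<η →
          P-up {ζ} (<⇒≤ (≰⇒> λ x≤v → ¬q (ζ , ζ<η , x≤v))) (proj₁ (v-isLeast ζ<η)))))
    where
    v : Ord ℓ → Ord ℓ
    v ζ = leastOr𝟎 (P ζ)
    v-isLeast : ∀ {ζ} → ζ < η → v ζ IsLeast P ζ
    v-isLeast {ζ} ζ<η = let (b , _ , p) = bound ζ<η in leastOr𝟎-isLeast (P ζ) (b , p)
    v<γ : ∀ ζ → ζ < η → v ζ < γ
    v<γ ζ ζ<η = let (b , b<γ , p) = bound ζ<η in ≤-<-trans (proj₂ (v-isLeast ζ<η) p) b<γ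
    v-cong : ∀ {ζ ζ′} → ζ < η → ζ ≈ ζ′ → v ζ ≈ v ζ′
    v-cong ζ<η (p , q) =
      proj₂ (v-isLeast ζ<η) (P-resp ζ′<η (q , p) (proj₁ (v-isLeast ζ′<η))) ,
      proj₂ (v-isLeast ζ′<η) (P-resp ζ<η (p , q) (proj₁ (v-isLeast ζ<η)))
      where ζ′<η = ≤-<-trans q ζ<η

  -- The block decomposition of `Ω`.

  module Blocks (δ κ : Ord ℓ) (cf : κ IsCofinalityOf ω^ δ) (ω≤κ : ω ≤ κ) (δs : Sequence κ)
    (Ω≈∑ : ω^ δ ≈ ∑ κ (λ ξ → ω^ (δs [ ξ ])))
    (δs-mono : ∀ ξ ζ → ξ < ζ → ζ < κ → δs [ ξ ] ≤ δs [ ζ ])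
    (δs-cf : ∀ ξ → ξ < κ → ∃ λ μ → μ IsCofinalityOf ω^ (δs [ ξ ]) × κ ≤ μ)
    where

    Ω : Ord ℓ
    Ω = ω^ δ

    a : Ord ℓ → Ord ℓ
    a ξ = ω^ (δs [ ξ ])

    -- Block ξ is the interval [S ξ , E ξ).
    S E : Ord ℓ → Ord ℓ
    S ξ = ∑ ξ a
    E ξ = S ξ + a ξ

    a-mono : ∀ {ξ ζ} → ξ ≤ ζ → ζ < κ → a ξ ≤ a ζ
    a-mono ξ≤ζ ζ<κ = ω^-mono-≤ ([ (λ ξ<ζ → δs-mono _ _ ξ<ζ ζ<κ)
      , (λ ξ≈ζ → lhs≤rhs (Sequence.cong δs (≤-<-trans ξ≤ζ ζ<κ) ξ≈ζ)) ]′ (≤⇒<⊎≈ ξ≤ζ))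

    S-mono : ∀ {ξ ζ} → ξ ≤ ζ → ζ ≤ κ → S ξ ≤ S ζ
    S-mono = ∑-mono-≤ a-mono

    E≤S : ∀ {ξ ζ} → ξ < ζ → ζ ≤ κ → E ξ ≤ S ζ
    E≤S = ∑-+≤∑ a-mono

    E-mono : ∀ {ξ ζ} → ξ ≤ ζ → ζ < κ → E ξ ≤ E ζ
    E-mono ξ≤ζ ζ<κ = +-mono-≤ (S-mono ξ≤ζ (<⇒≤ ζ<κ)) (a-mono ξ≤ζ ζ<κ)

    𝟏<Ω : 𝟏 < Ω
    𝟏<Ω = ≰⇒> λ Ω≤𝟏 → <⇒≱ (<-≤-trans (lift 1 , ≤-refl) ω≤κ)
      -- If `Ω ≤ 𝟏`, the constant map `𝟎` on `𝟏` is cofinal, which would force `κ ≤ 𝟏 < ω`.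
      (proj₂ cf 𝟏 ( record { _[_] = λ _ → 𝟎 ; cong = λ _ _ → ≤-refl , ≤-refl }
                  , (λ _ _ → 𝟎<ω^ δ)
                  , λ x x<Ω → 𝟎 , (_ , ≤-refl) , <sucₒ⇒≤ (<-≤-trans x<Ω Ω≤𝟏)))

    Ω-suc : ∀ {x} → x < Ω → sucₒ x < Ω
    Ω-suc x<Ω = ≤-<-trans (λ _ → inj₂ _ , α≤α+β {β = 𝟎}) (ω^-isIndecomposable δ x<Ω 𝟏<Ω)

    -- If η were the maximum of κ, a cofinal map on κ would stay cofinal
    -- when restricted to η, as Ω has no maximum.
    abstract
      κ-suc : ∀ {η} → η < κ → sucₒ η < κ
      κ-suc {η} η<κ = let ((h , h<Ω , h-cofinal) , κ-min) = cf in
        ≰⇒> λ κ≤sη → <⇒≱ η<κ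
          (κ-min η ( record { _[_] = h [_] ; cong = λ ξ<η → Sequence.cong h (<-trans ξ<η η<κ) }
                   , (λ ξ ξ<η → h<Ω ξ (<-trans ξ<η η<κ))
                   , λ x x<Ω → byContradiction λ ¬p →
                       let y = x + sucₒ (h [ η ])
                           hη<y = <-≤-trans <sucₒ (β≤α+β {α = x})
                           (ξ , ξ<κ , y≤hξ) = h-cofinal y (ω^-isIndecomposable δ x<Ω (Ω-suc (h<Ω η η<κ)))
                       in [ (λ ξ<η → ¬p (ξ , ξ<η , ≤-trans (α≤α+β {β = sucₒ (h [ η ])}) y≤hξ))
                          , (λ ξ≈η → <⇒≱ hη<y (≤-trans y≤hξ (lhs≤rhs (Sequence.cong h ξ<κ ξ≈η))))
                          ]′ (≤⇒<⊎≈ (<sucₒ⇒≤ (<-≤-trans ξ<κ κ≤sη)))))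

    E<Ω : ∀ {ξ} → ξ < κ → E ξ < Ω
    E<Ω ξ<κ =
      -- The block at `sucₒ ξ` lies between `E ξ` and `Ω`; being nonempty, it makes the inequality
      -- strict.
      ≤-<-trans (E≤S <sucₒ (<⇒≤ (κ-suc ξ<κ)))
        (<-≤-trans (α<α+β (𝟎<ω^ _)) (≤-trans (E≤S (κ-suc ξ<κ) ≤-refl) (rhs≤lhs Ω≈∑)))

    S<Ω : ∀ {ξ} → ξ < κ → S ξ < Ω
    S<Ω {ξ} ξ<κ = ≤-<-trans (α≤α+β {β = a ξ}) (E<Ω ξ<κ)

    -- The index of the block containing `x`. As a function it keeps `blocks` a predicate in
    -- `Set ℓ`; quantifying over indices would land in `Set (suc ℓ)`.
    idx : Ord ℓ → Ord ℓ
    idx x = leastOr𝟎 λ ξ → Lift (suc ℓ) (ξ < κ × x < E ξ)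

    <Ω⇒<E : ∀ {x} → x < Ω → ∃ λ ξ → ξ < κ × x < E ξ
    <Ω⇒<E x<Ω = <∑ (<-≤-trans x<Ω (lhs≤rhs Ω≈∑))

    module _ {x : Ord ℓ} (x<Ω : x < Ω) where

      private
        idx-isLeast : idx x IsLeast (λ ξ → Lift (suc ℓ) (ξ < κ × x < E ξ))
        idx-isLeast = let (ξ , p) = <Ω⇒<E x<Ω in leastOr𝟎-isLeast _ (ξ , lift p)

      idx<κ : idx x < κ
      idx<κ = proj₁ (lower (proj₁ idx-isLeast))

      <E-idx : x < E (idx x)
      <E-idx = proj₂ (lower (proj₁ idx-isLeast))

      idx-least : ∀ {ξ} → ξ < κ → x < E ξ → idx x ≤ ξ
      idx-least ξ<κ x<Eξ = proj₂ idx-isLeast (lift (ξ<κ , x<Eξ))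

      ≤idx : ∀ {ξ} → ξ < κ → S ξ ≤ x → ξ ≤ idx x
      ≤idx ξ<κ Sξ≤x = ≮⇒≥ λ idx<ξ → <⇒≱ <E-idx (≤-trans (E≤S idx<ξ (<⇒≤ ξ<κ)) Sξ≤x)

    idx-mono : ∀ {x y} → x ≤ y → y < Ω → idx x ≤ idx y
    idx-mono x≤y y<Ω = idx-least (≤-<-trans x≤y y<Ω) (idx<κ y<Ω) (≤-<-trans x≤y (<E-idx y<Ω))

    blocks : Subset κ → Subset Ω
    blocks A = record
      { pred    = λ x → x < Ω × pred A (idx x)
      ; resp    = λ (x≤y , y≤x) (x<Ω , idx∈A) → let y<Ω = ≤-<-trans y≤x x<Ω in
          y<Ω , Subset.resp A (idx-mono x≤y y<Ω , idx-mono y≤x x<Ω) idx∈A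
      ; bounded = proj₁
      }

    _from_ : Subset Ω → Ord ℓ → Subset Ω
    T from η = record
      { pred    = λ x → pred T x × η ≤ idx x
      ; resp    = λ x≈y (x∈T , p) → let y∈T = Subset.resp T x≈y x∈T in
          y∈T , ≤-trans p (idx-mono (lhs≤rhs x≈y) (Subset.bounded T y∈T))
      ; bounded = λ (x∈T , _) → Subset.bounded T x∈T
      }

    slice : Subset Ω → Ord ℓ → Pred (Ord ℓ) ℓ
    slice T ζ x = pred T x × ζ ≤ idx x × idx x ≤ ζ

    large-from : ∀ {η} (T : Subset Ω) → η < κ → Large T → Large (T from η)
    large-from {η} T η<κ T-large {β} β<Ω =
        let (y , y∈T , p) = T-large (ω^-isIndecomposable δ (S<Ω η<κ) β<Ω)
        in y , above y∈T (≤⟨⟩-mono (α≤α+β {β = β}) p) , ≤⟨⟩-drop above p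
      where
      above : ∀ {y} → pred T y → S η ≤⟨ pred T ⟩ y → pred (T from η) y
      above y∈T q = y∈T , ≤idx (Subset.bounded T y∈T) η<κ (≤⟨⟩⇒≤ q)

    abstract
      -- The cofinality hypothesis concerns `Ω`, so the bound is found there: the block starts
      -- `S c`, for fewer than `κ` indices `c`, lie below some `b < Ω`, and `idx b` then bounds the
      -- indices.
      small⇒bounded : (A : Subset κ) → Small A → Bounded A
      small⇒bounded A (β , β<κ , bij) =
          let (b , b<Ω , p) = collection cf β<κ Above
                (λ { _ (p , q) r c∈A (p′ , q′) → r c∈A (≤-trans p′ q , ≤-trans p q′) })
                (λ b≤b′ r c∈A e → ≤-trans (r c∈A e) b≤b′)
                bound
          in sucₒ (idx b) , κ-suc (idx<κ b<Ω) , λ {c} c∈A →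
            ≤-<-trans (≤idx b<Ω (Subset.bounded A c∈A) (p (proj₂ (to (c , c∈A))) c∈A (≤-refl , ≤-refl))) <sucₒ
        where
        open Bijection bij
        Above : Ord ℓ → Ord ℓ → Set (suc ℓ)
        Above ζ b = ∀ {c} (c∈A : pred A c) → proj₁ (to (c , c∈A)) ≈ ζ → S c ≤ b
        bound : ∀ {ζ} → ζ < β → ∃ λ b → b < Ω × Above ζ b
        bound ζ<β =
          let ((c , c∈A) , e) = surjective (_ , ζ<β)
              (p , q) = e {c , c∈A} (≤-refl , ≤-refl)
          in S c , S<Ω (Subset.bounded A c∈A) , λ {c′} c′∈A (p′ , q′) →
            S-mono (lhs≤rhs (injective {c′ , c′∈A} {c , c∈A} (≤-trans p′ q , ≤-trans p q′)))
                   (<⇒≤ (Subset.bounded A c∈A))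

    unbounded : (A : Subset κ) → ¬ Small A → ∀ {η} → η < κ → ∃ λ ζ → pred A ζ × η ≤ ζ
    unbounded A ¬small {η} η<κ = byContradiction λ ¬p →
      ¬small (bounded⇒small A (η , η<κ , λ ζ∈A → ≰⇒> λ η≤ζ → ¬p (_ , ζ∈A , η≤ζ)))

    -- By induction on `η`, type `E η` fits below some point of `Ω`: the earlier `E ζ` fit below a
    -- common `b`, which gives `S η`, and a slice of type at least `a η` beyond `b` is appended.
    large-fromSlices : (T : Subset Ω) →
      (∀ {ξ η} → ξ < κ → η < κ → ∃ λ ζ → η ≤ ζ × ζ < κ × a ξ ≤⟨ slice T ζ ⟩ Ω) → Large T
    large-fromSlices T slices β<Ω =
        let (ξ , ξ<κ , β<Eξ) = <Ω⇒<E β<Ω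
            (b , _ , p) = room (<-wellFounded ξ) ξ<κ
            (y , y∈T , _ , q) = ≤⟨⟩-below p β<Eξ
        in y , y∈T , q
      where
      room : ∀ {η} → Acc _<_ η → η < κ → ∃ λ b → b < Ω × E η ≤⟨ pred T ⟩ b
      room {η} (acc rs) η<κ with collection cf η<κ (λ ζ b → E ζ ≤⟨ pred T ⟩ b)
                                   (λ ζ<η (_ , ζ′≤ζ) → ≤⟨⟩-mono (E-mono ζ′≤ζ (<-trans ζ<η η<κ)))
                                   ≤⟨⟩-extend
                                   (λ ζ<η → room (rs ζ<η) (<-trans ζ<η η<κ))
      -- Asking for a block strictly after that of `b` places the whole slice above `b`.
      ... | b , b<Ω , p with slices η<κ (κ-suc (idx<κ b<Ω))
      ... | ζ , sidxb≤ζ , ζ<κ , q = E ζ , E<Ω ζ<κ ,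
          ≤⟨⟩-append (∑-≤⟨⟩ p)
            (λ (z∈T , ζ≤idxz , _) → z∈T , ≮⇒≥ λ z<b →
              <⇒≱ (<-≤-trans idxb<ζ ζ≤idxz) (idx-mono (<⇒≤ z<b) b<Ω))
            (≤-trans (<⇒≤ (<E-idx b<Ω)) (E-mono (<⇒≤ idxb<ζ) ζ<κ))
            (≤⟨⟩-shrink (λ z∈slice _ → z<Eζ z∈slice) q)
        where
        idxb<ζ : idx b < ζ
        idxb<ζ = <-≤-trans <sucₒ sidxb≤ζ
        z<Eζ : ∀ {z} → slice T ζ z → z < E ζ
        z<Eζ (z∈T , _ , idxz≤ζ) =
          <-≤-trans (<E-idx (Subset.bounded T z∈T)) (E-mono idxz≤ζ ζ<κ)

    -- An unbounded `A` has members `ζ` beyond both `ξ` and `η`; the whole block `ζ` is included and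
    -- has type `a ζ`, at least `a ξ`.
    blocks-large : (A : Subset κ) → ¬ Small A → Large (blocks A)
    blocks-large A ¬small = large-fromSlices (blocks A) λ ξ<κ η<κ →
      let (θ , θ<κ , ξ≤θ , η≤θ) = upperBound ξ<κ η<κ
          (ζ , ζ∈A , θ≤ζ) = unbounded A ¬small θ<κ
          ζ<κ = Subset.bounded A ζ∈A
      in ζ , ≤-trans η≤θ θ≤ζ , ζ<κ ,
        ≤⟨⟩-mono (a-mono (≤-trans ξ≤θ θ≤ζ) ζ<κ)
          (≤⟨⟩-extend (<⇒≤ (E<Ω ζ<κ)) (≤⟨⟩-interval ≤-refl λ Sζ≤y y<Eζ →
            let y<Ω = <-trans y<Eζ (E<Ω ζ<κ)
                ζ≤idx = ≤idx y<Ω ζ<κ Sζ≤y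
                idx≤ζ = idx-least y<Ω ζ<κ y<Eζ
            in (y<Ω , Subset.resp A (ζ≤idx , idx≤ζ) ζ∈A) , ζ≤idx , idx≤ζ))

    -- If all late slices of C had type below a ξ, then, as
    -- cf (a ξ) ≥ κ and a ξ is indecomposable, so would all initial
    -- segments of C from block η on, and C would be too short.
    largeSlice : (C : Subset Ω) → Large C → ∀ {ξ η} → ξ < κ → η < κ →
      ∃ λ ζ → η ≤ ζ × ζ < κ × a ξ ≤⟨ slice C ζ ⟩ Ω
    largeSlice C C-large {ξ} {η} ξ<κ η<κ = byContradiction λ none →
        let (y , y∈D , aξ≤y) = large-from C η<κ C-large (≤-<-trans (β≤α+β {α = S ξ}) (E<Ω ξ<κ))
            idxy<κ = idx<κ (Subset.bounded D y∈D)
            (v , v<aξ , short) = shortSegment none (<-wellFounded _) idxy<κ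
        in short y∈D ≤-refl (≤⟨⟩-mono (<⇒≤ v<aξ) aξ≤y)
      where
      D : Subset Ω
      D = C from η
      Short : Ord ℓ → Ord ℓ → Set (suc ℓ)
      Short ζ v = ∀ {x} → pred D x → idx x ≤ ζ → ¬ v ≤⟨ pred D ⟩ x
      module _ (none : ¬ ∃ λ ζ → η ≤ ζ × ζ < κ × a ξ ≤⟨ slice C ζ ⟩ Ω) where
        shortSlice : ∀ {ζ} → ζ < κ →
          ∃ λ t → t < a ξ × (∀ {y} → slice D ζ y → ¬ t ≤⟨ slice D ζ ⟩ y)
        shortSlice {ζ} ζ<κ = byContradiction λ ¬t →
          let long : a ξ ≤⟨ slice D ζ ⟩ Ω
              long = ≤⟨⟩-fromBelow λ {t} t<aξ → byContradiction λ ¬y → ¬t (t , t<aξ , λ y∈slice p →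
                ¬y (_ , y∈slice , Subset.bounded D (proj₁ y∈slice) , p))
              -- As `a ξ` is nonzero, the slice has an element; its lying in `D` shows `η ≤ ζ`.
              (_ , ((_ , η≤idx) , _ , idx≤ζ) , _) = ≤⟨⟩-below long (𝟎<ω^ _)
          in none (ζ , ≤-trans η≤idx idx≤ζ , ζ<κ ,
                   ≤⟨⟩-resp-⊆ (λ _ ((x∈C , _) , p) → x∈C , p) long)
        shortSegment : ∀ {ζ} → Acc _<_ ζ → ζ < κ → ∃ λ v → v < a ξ × Short ζ v
        shortSegment {ζ} (acc rs) ζ<κ with δs-cf ξ ξ<κ | shortSlice ζ<κ
        ... | μ , μ-cf , κ≤μ | t , t<aξ , ¬long
            with collection μ-cf (<-≤-trans ζ<κ κ≤μ) Short
                (λ _ (_ , ζ′≤ζ) r x∈D idx≤ζ′ → r x∈D (≤-trans idx≤ζ′ ζ′≤ζ))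
                (λ b≤b′ r x∈D idx≤ζ q → r x∈D idx≤ζ (≤⟨⟩-mono b≤b′ q))
                (λ ζ′<ζ → shortSegment (rs ζ′<ζ) (<-trans ζ′<ζ ζ<κ))
        -- No point of `D` in an earlier block has type `u` below it, so dropping `u` leaves only
        -- points of block `ζ`, which cannot realise `t`.
        ... | u , u<aξ , p = u + t , ω^-isIndecomposable _ u<aξ t<aξ , λ x∈D idx≤ζ q →
            ¬long (x∈D , above x∈D (≤⟨⟩-mono (α≤α+β {β = t}) q) , idx≤ζ)
              (≤⟨⟩-resp-⊆
                (λ y<x (y∈D , ζ≤idx) → y∈D , ζ≤idx ,
                  ≤-trans (idx-mono (<⇒≤ y<x) (Subset.bounded D x∈D)) idx≤ζ)
                (≤⟨⟩-drop {Y = λ y → pred D y × ζ ≤ idx y} (λ y∈D u≤y → y∈D , above y∈D u≤y) q))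
          where
          above : ∀ {y} → pred D y → u ≤⟨ pred D ⟩ y → ζ ≤ idx y
          above y∈D u≤y = ≮⇒≥ λ idx<ζ → p idx<ζ y∈D ≤-refl u≤y

    -- Reducing a copy of `Ω` to a set of indices.

    module Trace (C : Subset Ω) (C-large : Large C) where

      private
        Host : Ord ℓ → Ord ℓ → Set (suc ℓ)
        Host ξ ζ = ξ ≤ ζ × ζ < κ × a ξ ≤⟨ slice C ζ ⟩ Ω

      host : Ord ℓ → Ord ℓ
      host ξ = leastOr𝟎 (Host ξ)

      host-isLeast : ∀ {ξ} → ξ < κ → host ξ IsLeast Host ξ
      host-isLeast ξ<κ = leastOr𝟎-isLeast _ (largeSlice C C-large ξ<κ ξ<κ)

      host<κ : ∀ {ξ} → ξ < κ → host ξ < κ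
      host<κ ξ<κ = proj₁ (proj₂ (proj₁ (host-isLeast ξ<κ)))

      host-mono : ∀ {ξ ζ} → ξ ≤ ζ → ζ < κ → host ξ ≤ host ζ
      host-mono ξ≤ζ ζ<κ =
        let ((ζ≤host , host<κ , p) , _) = host-isLeast ζ<κ
        in proj₂ (host-isLeast (≤-<-trans ξ≤ζ ζ<κ))
             (≤-trans ξ≤ζ ζ≤host , host<κ , ≤⟨⟩-mono (a-mono ξ≤ζ ζ<κ) p)

      private
        Guest : Ord ℓ → Ord ℓ → Set (suc ℓ)
        Guest ζ ξ = Lift (suc ℓ) (ξ < κ × ζ ≤ host ξ)

      -- A canonical candidate for a preimage under `host`; it lets membership in the range be
      -- stated in `Set ℓ`, without quantifying over ordinals.
      guest : Ord ℓ → Ord ℓ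
      guest ζ = leastOr𝟎 (Guest ζ)

      guest-isLeast : ∀ {ζ} → ζ < κ → guest ζ IsLeast Guest ζ
      guest-isLeast {ζ} ζ<κ =
        leastOr𝟎-isLeast _ (ζ , lift (ζ<κ , proj₁ (proj₁ (host-isLeast ζ<κ))))

      guest<κ : ∀ {ζ} → ζ < κ → guest ζ < κ
      guest<κ ζ<κ = proj₁ (lower (proj₁ (guest-isLeast ζ<κ)))

      ≤host-guest : ∀ {ζ} → ζ < κ → ζ ≤ host (guest ζ)
      ≤host-guest ζ<κ = proj₂ (lower (proj₁ (guest-isLeast ζ<κ)))

      guest-least : ∀ {ζ ξ} → ζ < κ → ξ < κ → ζ ≤ host ξ → guest ζ ≤ ξ
      guest-least ζ<κ ξ<κ p = proj₂ (guest-isLeast ζ<κ) (lift (ξ<κ , p))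

      -- The range of host: as host is monotone, a value ζ of host is in
      -- particular its value at guest ζ.
      trace : Subset κ
      trace = record
        { pred    = λ ζ → ζ < κ × host (guest ζ) ≤ ζ
        ; resp    = λ (ζ≤ζ′ , ζ′≤ζ) (ζ<κ , p) → let ζ′<κ = ≤-<-trans ζ′≤ζ ζ<κ in
            ζ′<κ , ≤-trans (host-mono (guest-least ζ′<κ (guest<κ ζ<κ) (≤-trans ζ′≤ζ (≤host-guest ζ<κ)))
                                      (guest<κ ζ<κ))
                           (≤-trans p ζ≤ζ′)
        ; bounded = proj₁
        }

      host∈trace : ∀ {ξ} → ξ < κ → pred trace (host ξ)
      host∈trace ξ<κ = host<κ ξ<κ , host-mono (guest-least (host<κ ξ<κ) ξ<κ ≤-refl) ξ<κ

      trace-¬small : ¬ Small trace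
      trace-¬small small = ¬bounded (small⇒bounded trace small)
        where
        ¬bounded : ¬ Bounded trace
        ¬bounded (η , η<κ , trace<η) =
          <⇒≱ (trace<η (host∈trace η<κ)) (proj₁ (proj₁ (host-isLeast η<κ)))

      -- Here `ζ` equals `host (guest ζ)`, so its slice has type at least `a (guest ζ)`;
      -- monotonicity of `host` and `host ξ < ζ` force `ξ ≤ guest ζ`.
      trace-slice : ∀ {ξ ζ} → ξ < κ → pred trace ζ → host ξ < ζ → a ξ ≤⟨ slice C ζ ⟩ Ω
      trace-slice ξ<κ (ζ<κ , p) host<ζ =
        let ξ≤guest = ≮⇒≥ λ guest<ξ →
              <⇒≱ host<ζ (≤-trans (≤host-guest ζ<κ) (host-mono (<⇒≤ guest<ξ) ξ<κ))
        in ≤⟨⟩-resp-⊆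
             (λ _ (x∈C , q , r) → x∈C , ≤-trans (≤host-guest ζ<κ) q , ≤-trans r p)
             (≤⟨⟩-mono (a-mono ξ≤guest (guest<κ ζ<κ))
               (proj₂ (proj₂ (proj₁ (host-isLeast (guest<κ ζ<κ))))))

      -- Members of `B` beyond `θ` belong to the trace; those also beyond `η` and `host ξ` supply
      -- the required slices of `C`.
      trace-reduces : (B : Subset κ) → ¬ Small B → Bounded (B ∖ₛ trace) → Large (blocks B ∩ₛ C)
      trace-reduces B ¬small (θ , θ<κ , B∖trace<θ) = large-fromSlices (blocks B ∩ₛ C) slices
        where
        slices : ∀ {ξ η} → ξ < κ → η < κ →
          ∃ λ ζ → η ≤ ζ × ζ < κ × a ξ ≤⟨ slice (blocks B ∩ₛ C) ζ ⟩ Ω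
        slices ξ<κ η<κ with upperBound θ<κ η<κ
        ... | θ₁ , θ₁<κ , θ≤θ₁ , η≤θ₁ with upperBound θ₁<κ (κ-suc (host<κ ξ<κ))
        ... | θ₂ , θ₂<κ , θ₁≤θ₂ , host<θ₂ with unbounded B ¬small θ₂<κ
        ... | ζ , ζ∈B , θ₂≤ζ = ζ , ≤-trans η≤θ₁ θ₁≤ζ , Subset.bounded B ζ∈B ,
            ≤⟨⟩-resp-⊆
              (λ _ (x∈C , q , r) → ((Subset.bounded C x∈C , Subset.resp B (q , r) ζ∈B) , x∈C) , q , r)
              (trace-slice ξ<κ ζ∈trace (<-≤-trans <sucₒ (≤-trans host<θ₂ θ₂≤ζ)))
          where
          θ₁≤ζ : θ₁ ≤ ζ
          θ₁≤ζ = ≤-trans θ₁≤θ₂ θ₂≤ζ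
          ζ∈trace : pred trace ζ
          ζ∈trace = byContradictionₗ λ ζ∉trace →
            <⇒≱ (B∖trace<θ (ζ∈B , ζ∉trace)) (≤-trans θ≤θ₁ θ₁≤ζ)

    -- The complete embedding.

    copy : (T : Subset Ω) → Large T → RawRelation.Carrier (ℙ Ω)
    copy T T-large = T , large⇒copy T T-large

    ⊆⇒≤* : (p q : RawRelation.Carrier (ℙ Ω)) → pred (proj₁ p) ⊆ pred (proj₁ q) → _≤*_ (ℙ Ω) p q
    ⊆⇒≤* p q p⊆q s s⊆p = s , (λ x∈s → x∈s) , λ x∈s → p⊆q (s⊆p x∈s)

    embed : RawRelation.Carrier (𝒫 κ) → RawRelation.Carrier (ℙ Ω)
    embed (A , ¬small) = copy (blocks A) (blocks-large A ¬small)

    -- Cutting a copy inside `blocks A` down to the blocks from `η` on leaves a copy, and this one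
    -- lies inside `blocks B`.
    embed-mono : ∀ p q → Bounded (proj₁ p ∖ₛ proj₁ q) → _≤*_ (ℙ Ω) (embed p) (embed q)
    embed-mono (A , _) (B , _) (η , η<κ , A∖B<η) (s , s-copy) s⊆A =
      copy (s from η) (large-from s η<κ (copy⇒large s s-copy)) , proj₁ ,
      λ (x∈s , η≤idx) → let (x<Ω , idx∈A) = s⊆A x∈s in
        x<Ω , byContradictionₗ λ idx∉B → <⇒≱ (A∖B<η (idx∈A , idx∉B)) η≤idx

    -- A large set has points in arbitrarily late blocks.
    blocks-¬bounded : (A : Subset κ) (T : Subset Ω) → Large T → pred T ⊆ pred (blocks A) → ¬ Bounded A
    blocks-¬bounded A T T-large T⊆A (η , η<κ , A<η) =
      let (y , (y∈T , η≤idx) , _) = large-from T η<κ T-large (𝟎<ω^ δ)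
      in <⇒≱ (A<η (proj₂ (T⊆A y∈T))) η≤idx

    embed-isCompleteEmbedding : IsCompleteEmbedding (𝒫 κ) (sq (ℙ Ω)) embed
    embed-isCompleteEmbedding = record
      { isOrderHomomorphism = record
        { cong = λ {p} {q} small →
            let bounded = small⇒bounded (proj₁ p △ₛ proj₁ q) small
                bounded-by = λ X → bounded-resp-⊇ X (proj₁ p △ₛ proj₁ q)
            in embed-mono p q (bounded-by (proj₁ p ∖ₛ proj₁ q) inj₁ bounded) ,
               embed-mono q p (bounded-by (proj₁ q ∖ₛ proj₁ p) inj₂ bounded)
        ; mono = λ {p} {q} → mono p q
        }
      ; incompatible = λ p q → mk⇔
          (λ p⊥q (s , s≤p , s≤q) →
            -- Applying the two separative inequalities in turn refines `s` to a copy contained in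
            -- both images.
            let (t , t⊆s , t⊆p) = s≤p s (λ x∈s → x∈s)
                (u , u⊆t , u⊆q) = s≤q t t⊆s
            in p⊥q (meet p q u (λ x∈u → t⊆p (u⊆t x∈u)) u⊆q))
          (λ fp⊥fq (s , s⊑p , s⊑q) → fp⊥fq (embed s , mono s p s⊑p , mono s q s⊑q))
      ; reduction = λ (C , C-copy) →
          let C-large = copy⇒large C C-copy
              open Trace C C-large
          in (trace , trace-¬small) , λ (B , ¬small) small →
            let t = copy (blocks B ∩ₛ C) (trace-reduces B ¬small (small⇒bounded (B ∖ₛ trace) small))
            in t , ⊆⇒≤* t (embed (B , ¬small)) proj₁ , ⊆⇒≤* t (C , C-copy) proj₂
      }
      where
      mono : ∀ p q → Small (proj₁ p ∖ₛ proj₁ q) → _≤*_ (ℙ Ω) (embed p) (embed q)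
      mono p q small = embed-mono p q (small⇒bounded (proj₁ p ∖ₛ proj₁ q) small)
      meet : ∀ p q (u : RawRelation.Carrier (ℙ Ω)) →
             pred (proj₁ u) ⊆ pred (proj₁ (embed p)) → pred (proj₁ u) ⊆ pred (proj₁ (embed q)) →
             Compatible (𝒫 κ) p q
      meet (A , _) (B , _) (u , u-copy) u⊆A u⊆B =
        (A ∩ₛ B , λ small → blocks-¬bounded (A ∩ₛ B) u (copy⇒large u u-copy)
          (λ x∈u → proj₁ (u⊆A x∈u) , proj₂ (u⊆A x∈u) , proj₂ (u⊆B x∈u))
          (small⇒bounded (A ∩ₛ B) small)) ,
        -- Both differences are empty, hence bounded by `𝟎`.
        bounded⇒small ((A ∩ₛ B) ∖ₛ A) (𝟎 , 𝟎<κ , λ ((x∈A , _) , x∉A) → ⊥-elim (x∉A x∈A)) ,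
        bounded⇒small ((A ∩ₛ B) ∖ₛ B) (𝟎 , 𝟎<κ , λ ((_ , x∈B) , x∉B) → ⊥-elim (x∉B x∈B))
        where
        𝟎<κ : 𝟎 < κ
        𝟎<κ = <-≤-trans (lift 0 , ≤-refl) ω≤κ

mainTheorem8 : ∀ {ℓ : Level} → ExcludedMiddle (suc ℓ) →
    (δ κ : Ord ℓ) → κ IsCofinalityOf ω^ δ → ω ≤ κ →
    (δs : Sequence κ) →
    ω^ δ ≈ ∑ κ (λ ξ → ω^ (δs [ ξ ])) →
    (∀ ξ ζ → ξ < ζ → ζ < κ → δs [ ξ ] ≤ δs [ ζ ]) →
    (∀ ξ → ξ < κ → ∃ λ μ → μ IsCofinalityOf ω^ (δs [ ξ ]) × κ ≤ μ) →
    𝒫 κ ↪c sq (ℙ (ω^ δ))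
mainTheorem8 em δ κ cf ω≤κ δs Ω≈∑ δs-mono δs-cf = embed , embed-isCompleteEmbedding
  where open Classical.Blocks em δ κ cf ω≤κ δs Ω≈∑ δs-mono δs-cf
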